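{- Let $n$ be sufficiently large. In the $(1:1)$ WMaker--WBreaker Connectivity game on $E(K_n)$ (with WBreaker making the first move), WMaker has a strategy to win in at most $n+1$ moves, i.e. to ensure that after at most $n+1$ of her own moves the graph formed by her claimed edges contains a spanning tree of $K_n$.
   Context: The $(1:1)$ WMaker--WBreaker game on $E(K_n)$: two players, WMaker and WBreaker, alternately claim one edge of the complete graph $K_n$ per turn. Both players are walkers: at her/his first move a player chooses any vertex as starting position; when a player is positioned at a vertex $v$, she/he may only claim an edge incident with $v$ that has not previously been claimed by the opponent, and the other endpoint of the claimed edge becomes her/his new position. Unless stated otherwise WBreaker starts, so a round consists of a move of WBreaker followed by a move of WMaker. In the Connectivity game WMaker wins once her claimed edges contain the edge set of a spanning tree of $K_n$. -}

module Defs where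

open import Data.Nat using (ℕ; zero; suc; _∸_)
open import Data.Fin using (Fin; toℕ)
open import Data.Maybe using (Maybe; just; nothing)
open import Data.Product using (_×_; _,_; Σ; ∃)
open import Data.Sum using (_⊎_)
open import Data.Empty using (⊥)
open import Data.Unit using (⊤)
open import Data.List using (List; []; _∷_; length)
open import Data.List.Membership.Propositional using (_∈_)
open import Data.List.Relation.Unary.All using (All)
open import Data.List.Relation.Unary.Unique.Propositional using (Unique)
open import Relation.Binary.PropositionalEquality using (_≡_; _≢_)
open import Relation.Nullary using (¬_)
import Data.Nat as N

-- Vertices of K_n are Fin n. An edge {u,v} is recorded as an ordered pair (u , v);
-- orientation is irrelevant, see HasEdge.
EdgeList : ℕ → Set
EdgeList n = List (Fin n × Fin n)

HasEdge : ∀ {n} → EdgeList n → Fin n → Fin n → Set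
HasEdge E u v = ((u , v) ∈ E) ⊎ ((v , u) ∈ E)

data Reach {n : ℕ} (E : EdgeList n) : Fin n → Fin n → Set where
  here : ∀ {u} → Reach E u u
  step : ∀ {u v w} → HasEdge E u v → Reach E v w → Reach E u w

Connected : ∀ {n} → EdgeList n → Set
Connected {n} E = ∀ (u v : Fin n) → Reach E u v

SpanningTree : (n : ℕ) → EdgeList n → Set
SpanningTree n T =
  All (λ e → toℕ (Data.Product.proj₁ e) N.< toℕ (Data.Product.proj₂ e)) T
  × Unique T × length T ≡ n ∸ 1 × Connected T

-- Game state: edges claimed by WMaker, edges claimed by WBreaker,
-- and current positions (nothing = the player has not moved yet).
record State (n : ℕ) : Set where
  constructor st
  field
    makerEdges   : EdgeList n
    breakerEdges : EdgeList n
    makerPos     : Maybe (Fin n)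
    breakerPos   : Maybe (Fin n)
open State public

start : (n : ℕ) → State n
start n = st [] [] nothing nothing

StartOK : ∀ {n} → Maybe (Fin n) → Fin n → Set
StartOK nothing  u = ⊤
StartOK (just p) u = p ≡ u

LegalMove : ∀ {n} → Maybe (Fin n) → EdgeList n → Fin n → Fin n → Set
LegalMove p Opp u v = StartOK p u × u ≢ v × ¬ HasEdge Opp u v

breakerMove : ∀ {n} → State n → Fin n → Fin n → State n
breakerMove (st M B mp bp) u v = st M ((u , v) ∷ B) mp (just v)

makerMove : ∀ {n} → State n → Fin n → Fin n → State n
makerMove (st M B mp bp) u v = st ((u , v) ∷ M) B (just v) bp

MakerWon : ∀ {n} → State n → Set
MakerWon {n} s = ∃ λ T → SpanningTree n T × All (λ e → HasEdge (makerEdges s) (Data.Product.proj₁ e) (Data.Product.proj₂ e)) T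

MakerWinsWithin : ∀ {n} → ℕ → State n → Set
MakerWinsWithin zero s = ⊥
MakerWinsWithin (suc k) s =
  ∀ (u v : _) → LegalMove (breakerPos s) (makerEdges s) u v →
    let s₁ = breakerMove s u v in
    Σ _ λ x → Σ _ λ y → LegalMove (makerPos s₁) (breakerEdges s₁) x y ×
      (MakerWon (makerMove s₁ x y) ⊎ MakerWinsWithin k (makerMove s₁ x y))

{-# OPTIONS --safe #-}
-- WMaker walks to a new vertex in every round. As long as WBreaker claims no edge among the
-- unvisited vertices and WMaker's position p, or only one such edge, incident with p where he
-- also stands, she can restore this condition with a step to a new vertex. She is blocked only
-- when one or two vertices remain. Then she detours through a vertex w away from WBreaker with
-- all relevant edges free: a blocking edge must be claimed from one of its ends, so WBreaker
-- has to run after her and at most two detours are needed. Such a w exists since a walk of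
-- t edges meets at most about 2t/3 neighbours of a fixed set.
module Submission where

open import Defs
open import Data.Nat using (ℕ; suc; _≥_)
open import Data.Product using (∃)
open import Data.Nat using (zero; _+_; _*_; _≤_; _<_; z≤n; s≤s; _∸_)
open import Data.Nat.Properties
  using (module ≤-Reasoning; m+[n∸m]≡n; +-suc; *-suc; m+n≤o⇒m≤o; <-cmp; <⇒≱; *-cancelˡ-<;
         +-mono-≤; +-monoˡ-≤; +-monoʳ-≤; *-monoʳ-≤; n≤1+n; ≤-trans; ≤-refl; ≤-reflexive; suc-injective;
         +-identityʳ)
open import Data.Nat.Tactic.RingSolver using (solve-∀)
open import Data.Fin using (Fin; toℕ; _≟_)
open import Data.Fin.Properties using (toℕ-injective)
open import Data.List using (List; []; _∷_; [_]; _++_; length; allFin)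
open import Data.List.Properties using (length-++; length-tabulate)
open import Data.List.Membership.Propositional using (_∈_; _∉_; find; lose)
open import Data.List.Membership.Propositional.Properties using (∈-∃++; ∈-allFin; ∈-++⁺ˡ; ∈-++⁺ʳ)
import Data.List.Membership.DecPropositional as DecMembership
open import Data.List.Relation.Unary.Any using (any?; here; there)
open import Data.List.Relation.Unary.All as All using (All; []; _∷_)
open import Data.List.Relation.Unary.AllPairs using ([]; _∷_; tail)
open import Data.List.Relation.Unary.Unique.Propositional using (Unique)
open import Data.List.Relation.Unary.Unique.Propositional.Properties using (allFin⁺)
open import Data.List.Relation.Binary.Permutation.Propositional
  using (_↭_; ↭-refl; ↭-sym; ↭-reflexive; ↭-trans; ↭⇒↭ₛ; swap)
open import Data.List.Relation.Binary.Permutation.Propositional.Properties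
  using (∈-resp-↭; ↭-length; shift)
import Data.List.Relation.Binary.Permutation.Setoid.Properties as PermutationSetoid
open import Data.Maybe using (just; nothing)
open import Data.Product using (_×_; _,_; proj₁; proj₂)
open import Data.Sum using (_⊎_; inj₁; inj₂; [_,_]′; map)
open import Data.Unit using (tt)
open import Function using (_∘_; id; case_of_)
open import Relation.Binary using (tri<; tri≈; tri>)
open import Relation.Binary.PropositionalEquality
  using (_≡_; _≢_; refl; sym; trans; cong; subst; setoid; ≢-sym)
open import Relation.Nullary using (¬_; yes; no; ¬?; contradiction)
open import Relation.Nullary.Decidable using (decidable-stable)

-- Lists without repetitions, up to permutation

∈⇒↭ : ∀ {A : Set} {x : A} {xs} → x ∈ xs → ∃ λ ys → xs ↭ x ∷ ys
∈⇒↭ {x = x} x∈xs with ys , zs , eq ← ∈-∃++ x∈xs =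
  ys ++ zs , ↭-trans (↭-reflexive eq) (shift x ys zs)

Unique-resp-↭ : ∀ {A : Set} {xs ys : List A} → xs ↭ ys → Unique xs → Unique ys
Unique-resp-↭ {A} p = PermutationSetoid.Unique-resp-↭ (setoid A) (↭⇒↭ₛ p)

unique-⊆⇒length≤ : ∀ {A : Set} {xs ys : List A} → Unique xs →
                   (∀ {x} → x ∈ xs → x ∈ ys) → length xs ≤ length ys
unique-⊆⇒length≤ {xs = []} _ _ = z≤n
unique-⊆⇒length≤ {xs = x ∷ xs} (x∉xs ∷ u) xs⊆ys with zs , ys↭ ← ∈⇒↭ (xs⊆ys (here refl)) =
  subst (suc (length xs) ≤_) (sym (↭-length ys↭)) (s≤s (unique-⊆⇒length≤ u xs⊆zs))
  where
  xs⊆zs : ∀ {y} → y ∈ xs → y ∈ zs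
  xs⊆zs y∈xs with ∈-resp-↭ ys↭ (xs⊆ys (there y∈xs))
  ... | here refl = contradiction refl (All.lookup x∉xs y∈xs)
  ... | there y∈zs = y∈zs

unique-head : ∀ {A : Set} {x : A} {xs} → Unique (x ∷ xs) → x ∉ xs
unique-head (x∉xs ∷ _) x∈xs = All.lookup x∉xs x∈xs refl

-- Reachability and edge lists

reach-trans : ∀ {n} {E : EdgeList n} {u v w} → Reach E u v → Reach E v w → Reach E u w
reach-trans here       vw = vw
reach-trans (step e r) vw = step e (reach-trans r vw)

reach-weaken : ∀ {n} {E : EdgeList n} {e u v} → Reach E u v → Reach (e ∷ E) u v
reach-weaken here       = here
reach-weaken (step e r) = step (map there there e) (reach-weaken r)

hasEdge-swap : ∀ {n} {E : EdgeList n} {u v} → HasEdge E u v → HasEdge E v u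
hasEdge-swap (inj₁ e) = inj₂ e
hasEdge-swap (inj₂ e) = inj₁ e

hasEdge-weaken : ∀ {n} {E : EdgeList n} {e u v} → HasEdge E u v → HasEdge (e ∷ E) u v
hasEdge-weaken = map there there

hasEdge-∷⁻ : ∀ {n} {E : EdgeList n} {q r u v} → HasEdge ((q , r) ∷ E) u v →
             (u ≡ q × v ≡ r) ⊎ (u ≡ r × v ≡ q) ⊎ HasEdge E u v
hasEdge-∷⁻ (inj₁ (here refl)) = inj₁ (refl , refl)
hasEdge-∷⁻ (inj₁ (there e))   = inj₂ (inj₂ (inj₁ e))
hasEdge-∷⁻ (inj₂ (here refl)) = inj₂ (inj₁ (refl , refl))
hasEdge-∷⁻ (inj₂ (there e))   = inj₂ (inj₂ (inj₂ e))

¬hasEdge-∷ : ∀ {n} {E : EdgeList n} {q r u v} → ¬ (u ≡ q × v ≡ r) → ¬ (u ≡ r × v ≡ q) →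
             ¬ HasEdge E u v → ¬ HasEdge ((q , r) ∷ E) u v
¬hasEdge-∷ f g h = [ f , [ g , h ]′ ]′ ∘ hasEdge-∷⁻

-- Neighbours of a fixed set along a walk

data Walk {n} : EdgeList n → Fin n → Set where
  []   : ∀ {u} → Walk [] u
  move : ∀ {E u} v → Walk E u → Walk ((u , v) ∷ E) v

module _ {n} (S : List (Fin n)) where
  open DecMembership (_≟_ {n}) using (_∈?_)

  Covers : List (Fin n) → EdgeList n → Set
  Covers C E = ∀ {w s} → w ∉ S → s ∈ S → HasEdge E w s → w ∈ C

  -- Every edge pays 2 and every covered vertex costs 3. Ending inside S, or at a vertex already
  -- covered, allows a debt of 1 or 2: only edges entering or leaving S cover vertices, and
  -- entering S from a covered vertex costs nothing.
  data Balance (C : List (Fin n)) (q : Fin n) (t : ℕ) : Set where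
    inside  : q ∈ S         → 3 * length C ≤ 1 + 2 * t → Balance C q t
    covered : q ∉ S → q ∈ C → 3 * length C ≤ 2 + 2 * t → Balance C q t
    outside : q ∉ S         → 3 * length C ≤ 2 * t     → Balance C q t

  private
    -- Here `b` is the debt before the new edge and `a` the debt allowed after it; the edge itself
    -- pays 2.
    pay : ∀ a {b c t} → c ≤ b + 2 * t → b ≤ 2 + a → c ≤ a + 2 * suc t
    pay a {b} {c} {t} c≤ b≤ = begin
      c               ≤⟨ c≤ ⟩
      b + 2 * t       ≤⟨ +-monoˡ-≤ (2 * t) b≤ ⟩
      2 + a + 2 * t   ≡⟨ lemma a t ⟩
      a + 2 * suc t   ∎
      where
      open ≤-Reasoning
      lemma : ∀ a t → 2 + a + 2 * t ≡ a + 2 * suc t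
      lemma = solve-∀

    grow : ∀ a {b t} (x : Fin n) C → 3 * length C ≤ b + 2 * t → 3 + b ≤ 2 + a →
           3 * length (x ∷ C) ≤ a + 2 * suc t
    grow a {b} {t} x C c≤ b≤ = pay a {3 + b} (begin
      3 * length (x ∷ C)  ≡⟨ *-suc 3 (length C) ⟩
      3 + 3 * length C    ≤⟨ +-monoʳ-≤ 3 c≤ ⟩
      3 + (b + 2 * t)     ∎) b≤
      where open ≤-Reasoning

    Covers-∷ : ∀ {C C′ E q r} → Covers C E → (∀ {x} → x ∈ C → x ∈ C′) →
               (r ∈ S → q ∉ S → q ∈ C′) → (q ∈ S → r ∉ S → r ∈ C′) → Covers C′ ((q , r) ∷ E)
    Covers-∷ cov C⊆C′ q∈C′ r∈C′ w∉S s∈S e with hasEdge-∷⁻ e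
    ... | inj₁ (refl , refl)        = q∈C′ s∈S w∉S
    ... | inj₂ (inj₁ (refl , refl)) = r∈C′ s∈S w∉S
    ... | inj₂ (inj₂ e′)            = C⊆C′ (cov w∉S s∈S e′)

  cover : ∀ {E q} → Walk E q → ∃ λ C → Covers C E × Balance C q (length E)
  cover {q = q} [] with q ∈? S
  ... | yes q∈S = [] , (λ { _ _ (inj₁ ()) ; _ _ (inj₂ ()) }) , inside q∈S z≤n
  ... | no  q∉S = [] , (λ { _ _ (inj₁ ()) ; _ _ (inj₂ ()) }) , outside q∉S z≤n
  cover (move {E} {q} r walk) with cover walk | r ∈? S
  ... | C , cov , inside q∈S b | yes r∈S =
    C , Covers-∷ cov id (λ _ q∉S → contradiction q∈S q∉S) (λ _ r∉S → contradiction r∈S r∉S) ,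
    inside r∈S (pay 1 b (s≤s z≤n))
  -- Leaving `S` makes `r` a neighbour of `S`: it costs 3, the edge pays 2, and the debt rises from
  -- 1 to 2.
  ... | C , cov , inside q∈S b | no r∉S =
    r ∷ C , Covers-∷ cov there (λ r∈S → contradiction r∈S r∉S) (λ _ _ → here refl) ,
    covered r∉S (here refl) (grow 2 r C b ≤-refl)
  ... | C , cov , covered q∉S q∈C b | yes r∈S =
    C , Covers-∷ cov id (λ _ _ → q∈C) (λ q∈S → contradiction q∈S q∉S) ,
    inside r∈S (pay 1 b (n≤1+n 2))
  -- The vertex `q` is charged only when `S` is entered from it; the debt rises from 0 to 1.
  ... | C , cov , outside q∉S b | yes r∈S =
    q ∷ C , Covers-∷ cov there (λ _ _ → here refl) (λ q∈S → contradiction q∈S q∉S) ,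
    inside r∈S (grow 1 q C b ≤-refl)
  ... | C , cov , covered q∉S q∈C b | no r∉S =
    C , Covers-∷ cov id (λ r∈S → contradiction r∈S r∉S) (λ q∈S → contradiction q∈S q∉S) ,
    outside r∉S (pay 0 b ≤-refl)
  ... | C , cov , outside q∉S b | no r∉S =
    C , Covers-∷ cov id (λ r∈S → contradiction r∈S r∉S) (λ q∈S → contradiction q∈S q∉S) ,
    outside r∉S (pay 0 b z≤n)

  balance-bound : ∀ {C q t} → Balance C q t → 3 * length C ≤ 2 + 2 * t
  balance-bound (inside _ b)    = ≤-trans b (n≤1+n _)
  balance-bound (covered _ _ b) = b
  balance-bound (outside _ b)   = ≤-trans b (≤-trans (n≤1+n _) (n≤1+n _))

-- Finding a vertex away from WBreaker

module _ {n : ℕ} where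
  open DecMembership (_≟_ {n}) using (_∈?_)

  escape-or-⊆ : (U L : List (Fin n)) →
                (∃ λ f → f ∈ U × f ∉ L) ⊎ (∀ {x} → x ∈ U → x ∈ L)
  escape-or-⊆ U L with any? (λ f → ¬? (f ∈? L)) U
  ... | yes f = inj₁ (find f)
  ... | no ¬f = inj₂ (λ x∈U → decidable-stable (_ ∈? L) (λ x∉L → ¬f (lose x∈U x∉L)))

  escape : ∀ {U L} → Unique U → length L < length U → ∃ λ (f : Fin n) → f ∈ U × f ∉ L
  escape {U} {L} u L<U with escape-or-⊆ U L
  ... | inj₁ f   = f
  ... | inj₂ U⊆L = contradiction (unique-⊆⇒length≤ u U⊆L) (<⇒≱ L<U)

  private
    -- Three times the number of forbidden vertices is at most 12 + 2 + 2(n + 1) = 2n + 16, which is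
    -- below 3n once n is at least 17. The threshold of the theorem comes from here.
    few : ∀ {b s c} → 17 ≤ n → b ≤ suc n → s ≤ 3 → 3 * c ≤ 2 + 2 * b → suc (s + c) < n
    few {b} {s} {c} 17≤n b≤ s≤ c≤ = *-cancelˡ-< 3 _ _ (begin-strict
      3 * suc (s + c)          ≡⟨ lemma₁ s c ⟩
      3 * suc s + 3 * c        ≤⟨ +-mono-≤ (*-monoʳ-≤ 3 (s≤s s≤)) c≤ ⟩
      12 + (2 + 2 * b)         ≤⟨ +-monoʳ-≤ 14 (*-monoʳ-≤ 2 b≤) ⟩
      12 + (2 + 2 * suc n)     <⟨ ≤-reflexive (lemma₂ n) ⟩
      17 + 2 * n               ≤⟨ +-monoˡ-≤ (2 * n) 17≤n ⟩
      n + 2 * n                ≡⟨ lemma₃ n ⟩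
      3 * n                    ∎)
      where
      open ≤-Reasoning
      lemma₁ : ∀ s c → 3 * suc (s + c) ≡ 3 * suc s + 3 * c
      lemma₁ = solve-∀
      lemma₂ : ∀ k → suc (12 + (2 + 2 * suc k)) ≡ 17 + 2 * k
      lemma₂ = solve-∀
      lemma₃ : ∀ k → k + 2 * k ≡ 3 * k
      lemma₃ = solve-∀

  abstract
    -- Forbid `z`, the set `S` and a cover of the neighbours of `S`; by counting, some vertex is
    -- left. The vertex `z` is only avoided as a place, which lets WMaker keep off WBreaker's
    -- position without asking for free edges to it.
    remote : ∀ {B} {q : Fin n} → 17 ≤ n → Walk B q → length B ≤ suc n →
             ∀ S z → length S ≤ 3 →
             ∃ λ w → w ∉ S × w ≢ z × (∀ {s} → s ∈ S → ¬ HasEdge B s w)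
    remote 17≤n walk B≤ S z S≤3
      with C , cov , bal ← cover S walk
      with w , _ , w∉ ← escape {U = allFin n} {z ∷ S ++ C} (allFin⁺ n)
             (subst (length (z ∷ S ++ C) <_) (sym (length-tabulate {n = n} id))
               (subst (_< n) (cong suc (sym (length-++ S)))
                 (few {s = length S} {length C} 17≤n B≤ S≤3 (balance-bound S bal))))
      = w , w∉ ∘ there ∘ ∈-++⁺ˡ , w∉ ∘ here ,
        λ s∈S e → w∉ (there (∈-++⁺ʳ S (cov (w∉ ∘ there ∘ ∈-++⁺ˡ) s∈S (hasEdge-swap e))))

  -- The tree on the visited vertices

  record Explored (M : EdgeList n) (U : List (Fin n)) : Set where
    field
      -- The tree is kept apart from `M`, because a detour claims edges that may close cycles or
      -- repeat earlier ones.
      tree    : EdgeList n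
      ordered : All (λ e → toℕ (proj₁ e) < toℕ (proj₂ e)) tree
      unique  : Unique tree
      size    : length tree + length U ≡ n ∸ 1
      claimed : All (λ e → HasEdge M (proj₁ e) (proj₂ e)) tree
      avoids  : All (λ e → proj₁ e ∉ U × proj₂ e ∉ U) tree
      joined  : ∀ {v w} → v ∉ U → w ∉ U → Reach tree v w
      fresh   : Unique U
  open Explored

  explored-resp-↭ : ∀ {M U U′} → U ↭ U′ → Explored M U → Explored M U′
  explored-resp-↭ U↭ E = record
    { tree    = tree E
    ; ordered = ordered E
    ; unique  = unique E
    ; size    = trans (cong (length (tree E) +_) (sym (↭-length U↭))) (size E)
    ; claimed = claimed E
    ; avoids  = All.map (λ (a , b) → a ∘ back , b ∘ back) (avoids E)
    ; joined  = λ v∉ w∉ → joined E (v∉ ∘ ∈-resp-↭ U↭) (w∉ ∘ ∈-resp-↭ U↭)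
    ; fresh   = Unique-resp-↭ U↭ (fresh E)
    }
    where
    back : ∀ {v} → v ∈ _ → v ∈ _
    back = ∈-resp-↭ (↭-sym U↭)

  revisit : ∀ {M U e} → Explored M U → Explored (e ∷ M) U
  revisit E = record
    { tree    = tree E
    ; ordered = ordered E
    ; unique  = unique E
    ; size    = size E
    ; claimed = All.map hasEdge-weaken (claimed E)
    ; avoids  = avoids E
    ; joined  = joined E
    ; fresh   = fresh E
    }

  -- `SpanningTree` records an edge as an increasing pair, whichever way WMaker walked along it.
  orient : ∀ {u v : Fin n} → u ≢ v → ∃ λ e → toℕ (proj₁ e) < toℕ (proj₂ e)
           × (e ≡ (u , v) ⊎ e ≡ (v , u))
  orient {u} {v} u≢v with <-cmp (toℕ u) (toℕ v)
  ... | tri< u<v _ _ = (u , v) , u<v , inj₁ refl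
  ... | tri≈ _ u≡v _ = contradiction (toℕ-injective u≡v) u≢v
  ... | tri> _ _ v<u = (v , u) , v<u , inj₂ refl

  -- Old tree edges avoid `r`, so the new edge is not among them; every visited vertex reaches `r`
  -- through `p`.
  visit : ∀ {M p r U} → Explored M (r ∷ U) → p ∉ r ∷ U → Explored ((p , r) ∷ M) U
  visit {M} {p} {r} {U} E p∉ with orient (p∉ ∘ here)
  ... | e , e< , e≡ = record
    { tree    = e ∷ tree E
    ; ordered = e< ∷ ordered E
    ; unique  = All.map (λ (a , b) e≡e′ → new e≡ a b e≡e′) (avoids E) ∷ unique E
    ; size    = trans (sym (+-suc _ _)) (size E)
    ; claimed = claim e≡ ∷ All.map hasEdge-weaken (claimed E)
    ; avoids  = avoid e≡ ∷ All.map (λ (a , b) → a ∘ there , b ∘ there) (avoids E)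
    ; joined  = λ v∉ w∉ → reach-trans (to v∉) (from w∉)
    ; fresh   = tail (fresh E)
    }
    where
    new : ∀ {e e′} → e ≡ (p , r) ⊎ e ≡ (r , p) → proj₁ e′ ∉ r ∷ U → proj₂ e′ ∉ r ∷ U → e ≢ e′
    new (inj₁ refl) a b refl = b (here refl)
    new (inj₂ refl) a b refl = a (here refl)
    claim : ∀ {e} → e ≡ (p , r) ⊎ e ≡ (r , p) → HasEdge ((p , r) ∷ M) (proj₁ e) (proj₂ e)
    claim (inj₁ refl) = inj₁ (here refl)
    claim (inj₂ refl) = inj₂ (here refl)
    avoid : ∀ {e} → e ≡ (p , r) ⊎ e ≡ (r , p) → proj₁ e ∉ U × proj₂ e ∉ U
    avoid (inj₁ refl) = p∉ ∘ there , unique-head (fresh E)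
    avoid (inj₂ refl) = unique-head (fresh E) , p∉ ∘ there
    link : HasEdge (e ∷ tree E) p r
    link = map (here ∘ sym) (here ∘ sym) e≡
    extend : ∀ {v} → v ∉ U → v ≢ r → v ∉ r ∷ U
    extend v∉U v≢r (here v≡r) = v≢r v≡r
    extend v∉U v≢r (there v∈) = v∉U v∈
    to : ∀ {v} → v ∉ U → Reach (e ∷ tree E) v p
    to {v} v∉ with v ≟ r
    ... | yes refl = step (hasEdge-swap link) here
    ... | no v≢r   = reach-weaken (joined E (extend v∉ v≢r) p∉)
    from : ∀ {v} → v ∉ U → Reach (e ∷ tree E) p v
    from {v} v∉ with v ≟ r
    ... | yes refl = step link here
    ... | no v≢r   = reach-weaken (joined E p∉ (extend v∉ v≢r))

  -- MakerWon reads only the edges of WMaker.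
  explored⇒won : ∀ {M} → Explored M [] → MakerWon (st M [] nothing nothing)
  explored⇒won E = tree E ,
    (ordered E , unique E , trans (sym (+-identityʳ _)) (size E) ,
     λ v w → joined E {v} {w} (λ ()) (λ ())) ,
    claimed E

  -- Half rounds and the last step

  data MakerTurn (k : ℕ) (M B : EdgeList n) (p q : Fin n) : Set where
    -- The number `k` counts the full rounds that remain after this move.
    goto : ∀ y → p ≢ y → ¬ HasEdge B p y →
           MakerWon (st ((p , y) ∷ M) B (just y) (just q)) ⊎
           MakerWinsWithin k (st ((p , y) ∷ M) B (just y) (just q)) →
           MakerTurn k M B p q

  await : ∀ {k M B p q} → (∀ {r} → q ≢ r → MakerTurn k M ((q , r) ∷ B) p r) →
          MakerWinsWithin (suc k) (st M B (just p) (just q))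
  await turn u v (refl , u≢v , _) with turn u≢v
  ... | goto y p≢y free done = _ , y , (refl , p≢y , free) , done

  ∉-singleton : ∀ {x y : Fin n} → x ≢ y → x ∉ [ y ]
  ∉-singleton x≢y (here x≡y) = x≢y x≡y

  win : ∀ {k M B p q a} → Explored M [ a ] → p ≢ a → ¬ HasEdge B p a → MakerTurn k M B p q
  win E p≢a free = goto _ p≢a free (inj₁ (explored⇒won (visit E (∉-singleton p≢a))))

  -- WBreaker can claim an edge only from one of its ends. Standing at neither `p` nor `a`, he
  -- cannot block the last step in his next move.
  finish : ∀ {k M B p q a} → Explored M [ a ] → p ≢ a → ¬ HasEdge B p a → q ≢ a → q ≢ p →
           MakerWinsWithin (suc k) (st M B (just p) (just q))
  finish E p≢a free q≢a q≢p = await λ _ →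
    win E p≢a (¬hasEdge-∷ (λ (p≡q , _) → q≢p (sym p≡q)) (λ (_ , a≡q) → q≢a (sym a≡q)) free)

  -- A round passes from the budget to the length of WBreaker's walk, so their sum stays the same.
  spend : ∀ {a k m} → a + suc k ≤ m → suc a + k ≤ m
  spend {a} {k} {m} = subst (_≤ m) (+-suc a k)

  -- Endgame with one or two unvisited vertices

  module _ (17≤n : 17 ≤ n) where

    -- WMaker detours through `w`, with `pw` and `wa` free and WBreaker not at `w`. Unless he is at
    -- `a`, he cannot touch `wa` in time. From `a` he can block only by walking to `w`, and then a
    -- second detour through `x` leaves him at neither end of `xa`.
    one-left : ∀ {M B p q a} → Walk B q → length B + 2 ≤ suc n → Explored M [ a ] → p ≢ a →
               MakerTurn 2 M B p q
    one-left {M} {B} {p} {q} {a} walk B≤ E p≢a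
      with w , w∉ , w≢q , free ←
             remote 17≤n walk (m+n≤o⇒m≤o _ B≤) (a ∷ p ∷ []) q (s≤s (s≤s z≤n))
      = goto w (λ p≡w → w∉ (there (here (sym p≡w)))) (free (there (here refl))) (inj₂ rest)
      where
      w≢a : w ≢ a
      w≢a = w∉ ∘ here
      chase : Walk B a → MakerTurn 1 ((p , w) ∷ M) ((a , w) ∷ B) w w
      chase walk
        with x , x∉ , _ , free′ ←
               remote 17≤n (move w walk) (m+n≤o⇒m≤o _ (spend B≤)) (a ∷ w ∷ []) a (s≤s (s≤s z≤n))
        = goto x (λ w≡x → x∉ (there (here (sym w≡x)))) (free′ (there (here refl)))
            (inj₂ (finish (revisit (revisit E)) (x∉ ∘ here) (free′ (here refl) ∘ hasEdge-swap)
                     w≢a (λ w≡x → x∉ (there (here (sym w≡x))))))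
      rest : MakerWinsWithin 2 (st ((p , w) ∷ M) B (just w) (just q))
      rest with q ≟ a
      ... | no q≢a = finish (revisit E) w≢a (free (here refl) ∘ hasEdge-swap) q≢a (≢-sym w≢q)
      ... | yes refl = await answer
        where
        answer : ∀ {c} → a ≢ c → MakerTurn 1 ((p , w) ∷ M) ((a , c) ∷ B) w c
        answer {c} a≢c with c ≟ w
        ... | no c≢w = win (revisit E) w≢a
                         (¬hasEdge-∷ (w≢a ∘ proj₁) (λ (w≡c , _) → c≢w (sym w≡c))
                           (free (here refl) ∘ hasEdge-swap))
        ... | yes refl = chase walk

    -- This is the case where WBreaker, starting from `p` as well, has just claimed `pb`, and `pa`
    -- may be blocked too. WMaker detours through `w`, from which both `a` and `b` are free. If his
    -- next move from `b` is not to `a`, she walks to `a` and then along `ab`. If he claims `ba`,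
    -- she takes `b` and reaches `a` by a second detour.
    two-left : ∀ {M B p a b} → Walk B p → length B + 4 ≤ suc n → Explored M (a ∷ b ∷ []) →
               p ∉ a ∷ b ∷ [] → ¬ HasEdge B a b → MakerTurn 3 M ((p , b) ∷ B) p b
    two-left {M} {B} {p} {a} {b} walk B≤ E p∉ ab-free
      with w , w∉ , _ , free ←
             remote 17≤n (move b walk) (m+n≤o⇒m≤o _ (spend B≤)) (a ∷ b ∷ p ∷ []) b
               (s≤s (s≤s (s≤s z≤n)))
      = goto w (λ p≡w → w∉ (there (there (here (sym p≡w))))) (free (there (there (here refl))))
          (inj₂ (await λ {c} → answer c))
      where
      E₁ : Explored ((p , w) ∷ M) (a ∷ b ∷ [])
      E₁ = revisit E
      w≢a : w ≢ a
      w≢a = w∉ ∘ here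
      w≢b : w ≢ b
      w≢b = w∉ ∘ there ∘ here
      a≢b : a ≢ b
      a≢b = unique-head (fresh E) ∘ here
      w∉ab : w ∉ a ∷ b ∷ []
      w∉ab (here w≡a) = w≢a w≡a
      w∉ab (there (here w≡b)) = w≢b w≡b
      swapped : Explored ((p , w) ∷ M) (b ∷ a ∷ [])
      swapped = explored-resp-↭ (swap a b ↭-refl) E₁
      w∉ba : w ∉ b ∷ a ∷ []
      w∉ba = w∉ab ∘ ∈-resp-↭ (swap b a ↭-refl)
      answer : ∀ c → b ≢ c → MakerTurn 2 ((p , w) ∷ M) ((b , c) ∷ (p , b) ∷ B) w c
      answer c b≢c with c ≟ a
      ... | no c≢a =
        goto a w≢a
          (¬hasEdge-∷ (w≢b ∘ proj₁) (a≢b ∘ proj₂) (free (here refl) ∘ hasEdge-swap))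
          (inj₂ (finish (visit E₁ w∉ab) a≢b
            (¬hasEdge-∷ (a≢b ∘ proj₁) (λ (a≡c , _) → c≢a (sym a≡c))
              (¬hasEdge-∷ (λ (a≡p , _) → p∉ (here (sym a≡p))) (a≢b ∘ proj₁) ab-free))
            (≢-sym b≢c) c≢a))
      ... | yes refl =
        goto b w≢b
          (¬hasEdge-∷ (w≢b ∘ proj₁) (w≢a ∘ proj₁) (free (there (here refl)) ∘ hasEdge-swap))
          (inj₂ (await λ {e} → retreat e))
        where
        lemma : ∀ k → k + 4 ≡ 3 + k + 1
        lemma = solve-∀
        retreat : ∀ e → a ≢ e →
                  MakerTurn 1 ((w , b) ∷ (p , w) ∷ M) ((a , e) ∷ (b , a) ∷ (p , b) ∷ B) b e
        retreat e a≢e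
          -- WBreaker has to leave `a`, since he moves in every round. With `x` different from his
          -- new position `e`, he is at neither end of `xa` and `finish` applies. His walk has three
          -- more edges than `B`, still within the bound.
          with x , x∉ , x≢e , free′ ←
                 remote 17≤n (move e (move a (move b walk)))
                   (m+n≤o⇒m≤o (3 + length B) {1}
                     (subst (_≤ suc n) (lemma (length B)) B≤)) (a ∷ b ∷ []) e (s≤s (s≤s z≤n))
          = goto x (λ b≡x → x∉ (there (here (sym b≡x)))) (free′ (there (here refl)))
              (inj₂ (finish (revisit (visit swapped w∉ba)) (x∉ ∘ here)
                       (free′ (here refl) ∘ hasEdge-swap) (≢-sym a≢e) (≢-sym x≢e)))

    -- Main phase: a new vertex in every round

    Clear : EdgeList n → List (Fin n) → Set
    Clear B U = ∀ {x y} → x ∈ U → y ∈ U → ¬ HasEdge B x y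

    Contained : EdgeList n → List (Fin n) → Fin n → Fin n → Set
    Contained B U p q = (∀ {x} → x ∈ U → ¬ HasEdge B p x)
                      ⊎ (∃ λ d → q ≡ p × (∀ {x} → x ∈ U → HasEdge B p x → x ≡ d))

    -- There are m + 1 vertices to visit in m + 3 rounds, so two rounds are spare for detours. The
    -- bound on `length B` keeps WBreaker's walk short enough for `remote` to the end.
    keep-going : ∀ m {M B p q U} → Walk B q → length B + (3 + m) ≤ suc n → Explored M U →
                 length U ≡ suc m → p ∉ U → Clear B U → Contained B U p q →
                 MakerWinsWithin (3 + m) (st M B (just p) (just q))
    respond : ∀ m {M B p q r U} → Walk B q → length B + (3 + m) ≤ suc n → Explored M U →
              length U ≡ suc m → p ∉ U → Clear B U → Contained B U p q → q ≢ r →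
              MakerTurn (2 + m) M ((q , r) ∷ B) p r
    -- The list `L` holds all vertices of `U` blocked from `p`. Any vertex of `U` outside `L` will
    -- do: as `U` is clear, nothing is blocked from there, which is the first alternative of
    -- `Contained`.
    dodge : ∀ m {M B p q U} L → Walk B q → length B + (2 + m) ≤ suc n → Explored M U →
            length U ≡ suc m → p ∉ U → Clear B U → (∀ {x} → x ∈ U → HasEdge B p x → x ∈ L) →
            MakerTurn (2 + m) M B p q ⊎ (∀ {x} → x ∈ U → x ∈ L)
    advance : ∀ m {M B p q f U} → Walk B q → length B + (2 + m) ≤ suc n → Explored M U →
              length U ≡ suc m → p ∉ U → f ∈ U → ¬ HasEdge B p f →
              (∀ {U′} → (∀ {x} → x ∈ U′ → x ∈ U) → f ∉ U′ → Clear B U′ × Contained B U′ f q) →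
              MakerTurn (2 + m) M B p q

    -- WBreaker's new edge does not lie inside `U`, so it blocks at most one vertex of `U`, and only
    -- if `p` is one of its ends. WMaker is stuck only if that is the last vertex, which is left to
    -- `one-left`.
    evade : ∀ m {M B p q r U} → Walk B q → length B + (3 + m) ≤ suc n → Explored M U →
            length U ≡ suc m → p ∉ U → (∀ {x} → x ∈ U → ¬ HasEdge B p x) →
            Clear ((q , r) ∷ B) U → MakerTurn (2 + m) M ((q , r) ∷ B) p r

    keep-going m walk B≤ E len p∉ clear cont = await (respond m walk B≤ E len p∉ clear cont)

    advance m walk B≤ E len p∉ f∈ free inv with ∈⇒↭ f∈
    advance zero {U = a ∷ []} walk B≤ E len p∉ (here refl) free inv | _ =
      win E (p∉ ∘ here) free
    advance (suc m) {f = f} walk B≤ E len p∉ f∈ free inv | U′ , U↭ =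
      goto f (λ { refl → p∉ f∈ }) free
        (inj₂ (keep-going m walk B≤ (visit E′ (p∉ ∘ ∈-resp-↭ (↭-sym U↭)))
                 (suc-injective (trans (sym (↭-length U↭)) len)) f∉ (proj₁ inv′) (proj₂ inv′)))
      where
      E′ = explored-resp-↭ U↭ E
      f∉ : f ∉ U′
      f∉ = unique-head (fresh E′)
      inv′ = inv (λ x∈ → ∈-resp-↭ (↭-sym U↭) (there x∈)) f∉

    dodge m {U = U} L walk B≤ E len p∉ clear blocked with escape-or-⊆ U L
    ... | inj₂ U⊆L = inj₂ U⊆L
    ... | inj₁ (f , f∈ , f∉L) =
      inj₁ (advance m walk B≤ E len p∉ f∈ (f∉L ∘ blocked f∈)
             (λ U′⊆ _ → (λ x∈ y∈ → clear (U′⊆ x∈) (U′⊆ y∈)) , inj₁ (clear f∈ ∘ U′⊆)))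

    evade m {B = B} {p} {q} {r} {U} walk B≤ E len p∉ free clear =
      [ id , cornered m U B≤ E len p∉ ]′
        (dodge m [ target ] (move r walk) (spend B≤) E len p∉ clear blocked)
      where
      -- This is the end of the new edge other than `p`. If neither end is `p`, nothing is blocked
      -- and `q` is a harmless default.
      target : Fin n
      target with q ≟ p
      ... | yes _ = r
      ... | no  _ = q
      blocked : ∀ {x} → x ∈ U → HasEdge ((q , r) ∷ B) p x → x ∈ [ target ]
      blocked x∈ e with q ≟ p | hasEdge-∷⁻ e
      ... | yes _   | inj₁ (_ , x≡r)           = here x≡r
      ... | no q≢p  | inj₁ (p≡q , _)           = contradiction (sym p≡q) q≢p
      ... | yes q≡p | inj₂ (inj₁ (_ , refl))   = contradiction (subst (_∈ U) q≡p x∈) p∉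
      ... | no _    | inj₂ (inj₁ (_ , x≡q))    = here x≡q
      ... | _       | inj₂ (inj₂ e′)           = contradiction e′ (free x∈)
      cornered : ∀ m {M} U → length B + (3 + m) ≤ suc n → Explored M U → length U ≡ suc m →
                 p ∉ U → (∀ {x} → x ∈ U → x ∈ [ target ]) →
                 MakerTurn (2 + m) M ((q , r) ∷ B) p r
      cornered .0 (a ∷ []) B≤ E refl p∉ _ = one-left (move r walk) (spend B≤) E (p∉ ∘ here)
      cornered _ (a ∷ b ∷ U) _ E _ _ U⊆ with unique-⊆⇒length≤ (fresh E) U⊆
      ... | s≤s ()

    -- WBreaker also starts from `p`, so `U` stays clear and at most `d` and `r` are blocked from
    -- `p`.
    respond m {B = B} {p = p} {r = r} {U} walk B≤ E len p∉ clear (inj₂ (d , refl , only)) q≢r =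
      [ id , cornered m U B≤ E len p∉ clear ]′
        (dodge m (d ∷ r ∷ []) (move r walk) (spend B≤) E len p∉ clear′ blocked)
      where
      clear′ : Clear ((p , r) ∷ B) U
      clear′ x∈ y∈ = ¬hasEdge-∷ (λ { (refl , _) → p∉ x∈ }) (λ { (_ , refl) → p∉ y∈ }) (clear x∈ y∈)
      blocked : ∀ {x} → x ∈ U → HasEdge ((p , r) ∷ B) p x → x ∈ d ∷ r ∷ []
      blocked x∈ e with hasEdge-∷⁻ e
      ... | inj₁ (_ , refl)        = there (here refl)
      ... | inj₂ (inj₁ (_ , refl)) = contradiction x∈ p∉
      ... | inj₂ (inj₂ e′)         = here (only x∈ e′)
      cornered : ∀ m {M} U → length B + (3 + m) ≤ suc n → Explored M U → length U ≡ suc m →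
                 p ∉ U → Clear B U → (∀ {x} → x ∈ U → x ∈ d ∷ r ∷ []) →
                 MakerTurn (2 + m) M ((p , r) ∷ B) p r
      cornered .0 (a ∷ []) B≤ E refl p∉ _ _ = one-left (move r walk) (spend B≤) E (p∉ ∘ here)
      cornered .1 (a ∷ b ∷ []) B≤ E refl p∉ clear U⊆
        with U⊆ (here refl) | U⊆ (there (here refl))
      ... | here refl | here refl = contradiction (here refl) (unique-head (fresh E))
      -- Distinct vertices cannot both be `d`, so one of them is `r`, where WBreaker now stands. It
      -- must come second for `two-left`, hence the swap in the other case.
      ... | _ | there (here refl) =
        two-left walk B≤ E p∉ (clear (here refl) (there (here refl)))
      ... | there (here refl) | _ =
        two-left walk B≤ (explored-resp-↭ (swap a b ↭-refl) E) (p∉ ∘ ∈-resp-↭ (swap b a ↭-refl))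
          (clear (there (here refl)) (here refl))
      cornered _ (a ∷ b ∷ c ∷ U) _ E _ _ _ U⊆ with unique-⊆⇒length≤ (fresh E) U⊆
      ... | s≤s (s≤s ())
    respond m {M} {B} {p} {q} {r} {U} walk B≤ E len p∉ clear (inj₁ free) q≢r
      with q ∈? U | r ∈? U
    -- WBreaker has claimed an edge inside `U`. WMaker steps onto `r`, his own position: the edge
    -- `qr` is then no longer inside the unvisited set, and `q` is the only vertex blocked from `r`.
    -- This is the second alternative of `Contained`.
    ... | yes q∈ | yes r∈ =
      advance m (move r walk) (spend B≤) E len p∉ r∈
        (¬hasEdge-∷ (λ { (refl , _) → p∉ q∈ }) (λ { (refl , _) → p∉ r∈ }) (free r∈))
        (λ U′⊆ r∉ →
          (λ x∈ y∈ → ¬hasEdge-∷ (λ { (_ , refl) → r∉ y∈ }) (λ { (refl , _) → r∉ x∈ })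
                       (clear (U′⊆ x∈) (U′⊆ y∈))) ,
          inj₂ (q , refl , λ x∈ e → case hasEdge-∷⁻ e of λ where
            (inj₁ (r≡q , _))        → contradiction (sym r≡q) q≢r
            (inj₂ (inj₁ (_ , x≡q))) → x≡q
            (inj₂ (inj₂ e′))        → contradiction e′ (clear r∈ (U′⊆ x∈))))
    ... | no q∉ | _ = evade m walk B≤ E len p∉ free (λ x∈ y∈ →
      ¬hasEdge-∷ (λ { (refl , _) → q∉ x∈ }) (λ { (_ , refl) → q∉ y∈ }) (clear x∈ y∈))
    ... | _ | no r∉ = evade m walk B≤ E len p∉ free (λ x∈ y∈ →
      ¬hasEdge-∷ (λ { (_ , refl) → r∉ y∈ }) (λ { (refl , _) → r∉ x∈ }) (clear x∈ y∈))

    -- The first round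

    opening : ∀ m → n ≡ 3 + m → MakerWinsWithin (suc n) (start n)
    opening m n≡ u v (_ , u≢v , _)
      with y , _ , y∉ ← escape {U = allFin n} {u ∷ v ∷ []} (allFin⁺ n)
             (subst (2 <_) (sym (length-tabulate {n = n} id)) (≤-trans (s≤s (s≤s (s≤s z≤n))) 17≤n))
      with U , all↭ ← ∈⇒↭ (∈-allFin u)
      with ∈-resp-↭ all↭ (∈-allFin y)
    ... | here y≡u = contradiction (here y≡u) y∉
    ... | there y∈U with V , U↭ ← ∈⇒↭ y∈U =
      -- Starting at `u` makes one end of WBreaker's only edge visited, and since `y` is not `v`
      -- that edge misses the new position. After this round n - 2 = m + 1 vertices and n = m + 3
      -- rounds are left, as `keep-going` requires.
      u , y , (tt , u≢y , ¬hasEdge-∷ (λ (_ , y≡v) → y∉ (there (here y≡v))) (u≢v ∘ proj₁) none) ,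
      inj₂ (subst (λ k → MakerWinsWithin k (st [ u , y ] [ u , v ] (just y) (just v))) (sym n≡)
        (keep-going m (move v []) (≤-reflexive (cong suc (sym n≡)))
          (visit initial (u∉U ∘ ∈-resp-↭ (↭-sym U↭))) V-length (unique-head (fresh initial))
          (λ x∈ z∈ → ¬hasEdge-∷ (λ { (refl , _) → u∉V x∈ }) (λ { (_ , refl) → u∉V z∈ }) none)
          (inj₁ (λ x∈ → ¬hasEdge-∷ (u≢y ∘ sym ∘ proj₁) (λ { (_ , refl) → u∉V x∈ }) none))))
      where
      u≢y : u ≢ y
      u≢y u≡y = y∉ (here (sym u≡y))
      none : ∀ {x z} → ¬ HasEdge {n} [] x z
      none (inj₁ ())
      none (inj₂ ())
      unique-u∷U : Unique (u ∷ U)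
      unique-u∷U = Unique-resp-↭ all↭ (allFin⁺ n)
      u∉U : u ∉ U
      u∉U = unique-head unique-u∷U
      u∉V : u ∉ V
      u∉V u∈V = u∉U (∈-resp-↭ (↭-sym U↭) (there u∈V))
      u∷U-length : suc (length U) ≡ n
      u∷U-length = trans (sym (↭-length all↭)) (length-tabulate {n = n} id)
      V-length : length V ≡ suc m
      V-length = suc-injective (suc-injective
        (trans (cong suc (sym (↭-length U↭))) (trans u∷U-length n≡)))
      visited : ∀ {x} → x ∉ U → x ≡ u
      visited {x} x∉ with ∈-resp-↭ all↭ (∈-allFin x)
      ... | here x≡u = x≡u
      ... | there x∈ = contradiction x∈ x∉
      initial : Explored [] (y ∷ V)
      initial = explored-resp-↭ U↭ record
        { tree    = []
        ; ordered = []
        ; unique  = []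
        ; size    = cong (_∸ 1) u∷U-length
        ; claimed = []
        ; avoids  = []
        ; joined  = λ {x} {z} x∉ z∉ →
            subst (λ z → Reach [] x z) (trans (visited x∉) (sym (visited z∉))) here
        ; fresh   = tail unique-u∷U
        }

theorem1 : ∃ λ n₀ → ∀ (n : ℕ) → n ≥ n₀ → MakerWinsWithin (suc n) (start n)
theorem1 = 17 , λ n 17≤n →
  opening 17≤n (n ∸ 3) (sym (m+[n∸m]≡n (≤-trans (s≤s (s≤s (s≤s z≤n))) 17≤n)))
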